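{- Let $C_{(<,\geq)}(x,y)$ and $C_{(\neq,\geq)}(x,y)$ be the bivariate generating functions of the Catalan words avoiding the ordered pairs of relations $(<,\geq)$ and $(\neq,\geq)$, respectively, where $x$ marks the length and $y$ marks the number of descents. Then $$C_{(<,\geq)}(x,y)=C_{(\neq,\geq)}(x,y)=1+\frac{1}{1-x}\cdot\frac{x}{1-x}=\frac {1-x+x^2}{ \left(1-x \right) ^{2}}.$$
   Context: A Catalan word of length $n$ is a word $w=w_1w_2\cdots w_n$ over the non-negative integers with $w_1=0$ and $0\leq w_i\leq w_{i-1}+1$ for $i=2,\dots,n$; the empty word is the unique Catalan word of length $0$. For relations $X,Y\in\{<,>,\leq,\geq,=,\neq\}$, a word $w$ contains the pattern $(X,Y)$ if there is an index $i\geq 1$ (with $i+2\le n$) such that $w_i\,X\,w_{i+1}$ and $w_{i+1}\,Y\,w_{i+2}$; otherwise $w$ avoids $(X,Y)$. The number of descents $\mathrm{des}(w)$ is the number of indices $i$ with $w_i>w_{i+1}$. The bivariate generating function is $C_{(X,Y)}(x,y)=\sum_{w}x^{|w|}y^{\mathrm{des}(w)}$, the sum being over all Catalan words $w$ (of any length $|w|\geq 0$) avoiding $(X,Y)$. Identities are between formal power series in $x$ with coefficients polynomials in $y$. -}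

module Defs where

open import Algebra.Bundles using (Ring)
open import Algebra.Bundles.Raw using (RawRing)
import Algebra.Definitions.RawSemiring as RawSemiringDefinitions
open import Data.Bool.Base using (if_then_else_)
open import Data.Fin.Base using (Fin; zero; suc; toℕ)
import Data.Integer.Base as ℤ
open import Data.List.Base
  using (List; []; _∷_; [_]; map; foldr; filter; concatMap; upTo; head; length)
open import Data.List.Membership.Propositional using (_∈_)
open import Data.List.Membership.Propositional.Properties
  using (∈-map⁺; ∈-map⁻; ∈-++⁺ˡ; ∈-++⁺ʳ; ∈-++⁻; ∈-upTo⁺; ∈-upTo⁻)
open import Data.List.Relation.Unary.All as All using (All; []; _∷_)
open import Data.List.Relation.Unary.AllPairs using ([]; _∷_)
open import Data.List.Relation.Unary.Any using (here; there)
open import Data.List.Relation.Unary.Linked using (Linked; []; [-]; _∷_)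
open import Data.List.Relation.Unary.Unique.Propositional using (Unique)
import Data.List.Relation.Unary.Unique.Propositional.Properties as Unique
open import Data.List.Properties using (∷-injectiveˡ; ∷-injectiveʳ)
open import Data.Maybe.Relation.Unary.All as Maybe using (just; nothing)
open import Data.Nat.Base as ℕ
  using (ℕ; zero; suc; _∸_; _≤_; s≤s; s≤s⁻¹)
open import Data.Nat.Properties using (_≟_; _>?_)
open import Data.Product.Base using (∃; _×_; _,_)
open import Data.Sum.Base using (inj₁; inj₂)
open import Data.Vec.Base as Vec using (Vec; []; _∷_; lookup)
open import Level using (Level; 0ℓ)
open import Relation.Binary.Core using (Rel)
open import Relation.Binary.Definitions using (Decidable)
open import Relation.Binary.PropositionalEquality.Core
  using (_≡_; _≢_; refl; cong; sym)
open import Relation.Nullary.Decidable using (does; yes; no; ¬?)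
open import Relation.Nullary.Negation using (¬_)
import Relation.Unary as Unary

private
  variable
    X Y : Rel ℕ 0ℓ

IsCatalan : List ℕ → Set
IsCatalan w = Maybe.All (_≡ 0) (head w) × Linked (λ a b → b ≤ suc a) w

data Contains (X Y : Rel ℕ 0ℓ) : List ℕ → Set where
  here  : ∀ {a b c w} → X a b → Y b c → Contains X Y (a ∷ b ∷ c ∷ w)
  there : ∀ {a w} → Contains X Y w → Contains X Y (a ∷ w)

Avoids : (X Y : Rel ℕ 0ℓ) → List ℕ → Set
Avoids X Y w = ¬ Contains X Y w

contains? : Decidable X → Decidable Y → Unary.Decidable (Contains X Y)
contains? X? Y? []          = no λ ()
contains? X? Y? (a ∷ [])     = no λ { (there ()) }
contains? X? Y? (a ∷ b ∷ []) = no λ { (there (there ())) }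
contains? X? Y? (a ∷ b ∷ c ∷ w) with X? a b | Y? b c | contains? X? Y? (b ∷ c ∷ w)
... | _        | _        | yes found  = yes (there found)
... | yes Xab  | yes Ybc  | no _       = yes (here Xab Ybc)
... | no ¬Xab  | _        | no ¬found  = no λ { (here Xab _) → ¬Xab Xab ; (there p) → ¬found p }
... | yes _    | no ¬Ybc  | no ¬found  = no λ { (here _ Ybc) → ¬Ybc Ybc ; (there p) → ¬found p }

avoids? : Decidable X → Decidable Y → Unary.Decidable (Avoids X Y)
avoids? X? Y? w = ¬? (contains? X? Y? w)

infix 4 _≢?_
_≢?_ : Decidable {A = ℕ} _≢_
a ≢? b = ¬? (a ≟ b)

des : List ℕ → ℕ
des []          = 0
des (a ∷ [])    = 0
des (a ∷ b ∷ w) = (if does (a >? b) then 1 else 0) ℕ.+ des (b ∷ w)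

-- The words of length n that can follow a letter a in a Catalan word.
continuations : ℕ → ℕ → List (List ℕ)
continuations a zero    = [ [] ]
continuations a (suc n) = concatMap (λ b → map (b ∷_) (continuations b n)) (upTo (2 ℕ.+ a))

-- By the three lemmas below, this lists every Catalan word of length n
-- exactly once.
catalanWords : ℕ → List (List ℕ)
catalanWords zero    = [ [] ]
catalanWords (suc n) = map (0 ∷_) (continuations 0 n)

private
  Prepend : (ℕ → List (List ℕ)) → List ℕ → List (List ℕ)
  Prepend f = concatMap (λ b → map (b ∷_) (f b))

  prepend⁺ : ∀ f {b w bs} → b ∈ bs → w ∈ f b → b ∷ w ∈ Prepend f bs
  prepend⁺ f (here refl) w∈           = ∈-++⁺ˡ (∈-map⁺ _ w∈)
  prepend⁺ f {bs = b ∷ _} (there b∈) w∈ = ∈-++⁺ʳ (map (b ∷_) (f b)) (prepend⁺ f b∈ w∈)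

  prepend⁻ : ∀ f {v} bs → v ∈ Prepend f bs → ∃ λ b → ∃ λ w → v ≡ b ∷ w × b ∈ bs × w ∈ f b
  prepend⁻ f (b ∷ bs) v∈ with ∈-++⁻ (map (b ∷_) (f b)) v∈
  ... | inj₁ v∈ˡ with w , w∈ , refl ← ∈-map⁻ _ v∈ˡ = b , w , refl , here refl , w∈
  ... | inj₂ v∈ʳ with c , w , eq , c∈ , w∈ ← prepend⁻ f bs v∈ʳ = c , w , eq , there c∈ , w∈

  prepend-unique : ∀ f {bs} → (∀ b → Unique (f b)) → Unique bs → Unique (Prepend f bs)
  prepend-unique f f! [] = []
  prepend-unique f {b ∷ bs} f! (b∉ ∷ bs!) =
    Unique.++⁺ (Unique.map⁺ ∷-injectiveʳ (f! b)) (prepend-unique f f! bs!) disjoint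
    where
    disjoint : ∀ {v} → ¬ (v ∈ map (b ∷_) (f b) × v ∈ Prepend f bs)
    disjoint (v∈ˡ , v∈ʳ)
      with _ , _ , refl ← ∈-map⁻ _ v∈ˡ
         | _ , _ , eq , c∈ , _ ← prepend⁻ f bs v∈ʳ = All.lookup b∉ c∈ (∷-injectiveˡ eq)

  continuations-sound : ∀ a n {w} → w ∈ continuations a n →
                        Linked (λ a b → b ≤ suc a) (a ∷ w) × length w ≡ n
  continuations-sound a zero (here refl) = [-] , refl
  continuations-sound a (suc n) v∈
    with b , w , refl , b∈ , w∈ ← prepend⁻ (λ b → continuations b n) (upTo (2 ℕ.+ a)) v∈
    with l , len ← continuations-sound b n w∈ = s≤s⁻¹ (∈-upTo⁻ b∈) ∷ l , cong suc len

  continuations-complete : ∀ a {w} → Linked (λ a b → b ≤ suc a) (a ∷ w) →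
                           w ∈ continuations a (length w)
  continuations-complete a [-] = here refl
  continuations-complete a {b ∷ w} (b≤ ∷ l) =
    prepend⁺ (λ b → continuations b (length w)) (∈-upTo⁺ (s≤s b≤)) (continuations-complete b l)

  continuations-unique : ∀ a n → Unique (continuations a n)
  continuations-unique a zero    = [] ∷ []
  continuations-unique a (suc n) =
    prepend-unique (λ b → continuations b n) (λ b → continuations-unique b n) (Unique.upTo⁺ (2 ℕ.+ a))

catalanWords-sound : ∀ n {w} → w ∈ catalanWords n → IsCatalan w × length w ≡ n
catalanWords-sound zero (here refl) = (nothing , []) , refl
catalanWords-sound (suc n) v∈ with w , w∈ , refl ← ∈-map⁻ _ v∈
  with l , len ← continuations-sound 0 n w∈ = (just refl , l) , cong suc len

catalanWords-complete : ∀ {w} → IsCatalan w → w ∈ catalanWords (length w)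
catalanWords-complete {[]}    _                = here refl
catalanWords-complete {_ ∷ w} (just refl , l) = ∈-map⁺ _ (continuations-complete 0 l)

catalanWords-unique : ∀ n → Unique (catalanWords n)
catalanWords-unique zero    = [] ∷ []
catalanWords-unique (suc n) = Unique.map⁺ ∷-injectiveʳ (continuations-unique 0 n)

-- A polynomial is its list of coefficients, constant term first; trailing
-- zeros are allowed, so equality is coefficientwise.
module Polynomial {c ℓ : Level} (R : RawRing c ℓ) where
  private module R = RawRing R

  Poly : Set c
  Poly = List R.Carrier

  coeff : Poly → ℕ → R.Carrier
  coeff []      k       = R.0#
  coeff (a ∷ p) zero    = a
  coeff (a ∷ p) (suc k) = coeff p k

  infix 4 _≈ₚ_
  _≈ₚ_ : Rel Poly ℓ
  p ≈ₚ q = ∀ k → coeff p k R.≈ coeff q k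

  infixl 6 _+ₚ_
  _+ₚ_ : Poly → Poly → Poly
  []      +ₚ q       = q
  (a ∷ p) +ₚ []      = a ∷ p
  (a ∷ p) +ₚ (b ∷ q) = (a R.+ b) ∷ (p +ₚ q)

  infixl 7 _*ₚ_
  _*ₚ_ : Poly → Poly → Poly
  []      *ₚ q = []
  (a ∷ p) *ₚ q = map (a R.*_) q +ₚ (R.0# ∷ (p *ₚ q))

  rawRing : RawRing c ℓ
  rawRing = record
    { Carrier = Poly
    ; _≈_     = _≈ₚ_
    ; _+_     = _+ₚ_
    ; _*_     = _*ₚ_
    ; -_      = map R.-_
    ; 0#      = []
    ; 1#      = [ R.1# ]
    }

  indeterminate : Poly
  indeterminate = R.0# ∷ R.1# ∷ []

module PowerSeries {c ℓ : Level} (R : RawRing c ℓ) where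
  private
    module R = RawRing R
    open RawSemiringDefinitions R.rawSemiring using (sum)

  Series : Set c
  Series = ℕ → R.Carrier

  constant : R.Carrier → Series
  constant a zero    = a
  constant a (suc _) = R.0#

  x : Series
  x zero          = R.0#
  x (suc zero)    = R.1#
  x (suc (suc _)) = R.0#

  rawRing : RawRing c ℓ
  rawRing = record
    { Carrier = Series
    ; _≈_     = λ f g → ∀ n → f n R.≈ g n
    ; _+_     = λ f g n → f n R.+ g n
    ; _*_     = λ f g n → sum {suc n} λ i → f (toℕ i) R.* g (n ∸ toℕ i)
    ; -_      = λ f n → R.- f n
    ; 0#      = λ _ → R.0#
    ; 1#      = constant R.1#
    }

  open RawRing rawRing public using (_≈_; _+_; _*_; -_; 0#; 1#)
  open RawSemiringDefinitions (RawRing.rawSemiring rawRing) public using (_^_)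

  infixl 6 _-_
  _-_ : Series → Series → Series
  f - g = f + (- g)

  -- If g = 1/f and f has constant term 1, then g₀ = 1 and
  -- gₙ₊₁ = - (f₁ gₙ + f₂ gₙ₋₁ + ⋯ + fₙ₊₁ g₀).
  -- The vector holds gₙ, …, g₁, g₀ in this order.
  reciprocalCoeffs : Series → (n : ℕ) → Vec R.Carrier (suc n)
  reciprocalCoeffs f zero    = R.1# ∷ []
  reciprocalCoeffs f (suc n) =
    let gs = reciprocalCoeffs f n
    in (R.- sum λ i → f (suc (toℕ i)) R.* lookup gs i) ∷ gs

  -- The multiplicative inverse of f, provided that f has constant term 1
  -- (see *-inverseʳ below); a meaningless value otherwise.
  infix 9 _⁻¹
  _⁻¹ : Series → Series
  (f ⁻¹) n = Vec.head (reciprocalCoeffs f n)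

  infixl 7 _/_
  _/_ : Series → Series → Series
  f / g = f * g ⁻¹

module PowerSeriesProperties {c ℓ : Level} (R : Ring c ℓ) where
  private
    module R = Ring R
    open import Algebra.Properties.Monoid.Sum R.+-monoid using (sum-cong-≋)
  open PowerSeries R.rawRing

  private
    lookup-reciprocalCoeffs : ∀ f n (i : Fin (suc n)) →
                              lookup (reciprocalCoeffs f n) i ≡ (f ⁻¹) (n ∸ toℕ i)
    lookup-reciprocalCoeffs f zero    zero    = refl
    lookup-reciprocalCoeffs f (suc n) zero    = refl
    lookup-reciprocalCoeffs f (suc n) (suc i) = lookup-reciprocalCoeffs f n i

  *-inverseʳ : ∀ f → f 0 R.≈ R.1# → f * f ⁻¹ ≈ 1#
  *-inverseʳ f f₀≈1 zero    =
    R.trans (R.+-identityʳ _) (R.trans (R.*-congʳ f₀≈1) (R.*-identityˡ _))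
  *-inverseʳ f f₀≈1 (suc n) = R.trans
    (R.+-cong (R.trans (R.*-congʳ f₀≈1) (R.*-identityˡ _))
              (sum-cong-≋ λ i → R.*-congˡ {f (suc (toℕ i))} (R.reflexive (sym (lookup-reciprocalCoeffs f n i)))))
    (R.-‿inverseˡ _)

module ℤ[y] = Polynomial ℤ.+-*-rawRing
module ℤ[y]⟦x⟧ = PowerSeries ℤ[y].rawRing

y : ℤ[y].Poly
y = ℤ[y].indeterminate

-- Coefficient of xⁿ in C: the sum of y ^ des w over the Catalan words w of
-- length n that avoid (X, Y).
C : Decidable X → Decidable Y → ℤ[y]⟦x⟧.Series
C X? Y? n = foldr _+_ 0# (map (λ w → y ^ des w) (filter (avoids? X? Y?) (catalanWords n)))
  where
  open RawRing ℤ[y].rawRing using (rawSemiring; _+_; 0#)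
  open RawSemiringDefinitions rawSemiring using (_^_)

{-# OPTIONS --safe #-}
-- After its first rise, a Catalan word avoiding (<, ≥) or (≠, ≥) must keep
-- rising, and before its first rise it consists of zeros. So for n ≥ 1 the
-- avoiding words of length n are the n words 0 ⋯ 0 1 2 ⋯ m, none of which has a
-- descent. Since y does not occur on the right-hand sides either, these are
-- evaluated in ℤ⟦x⟧, where the inverses of 1 - x and (1 - x)² have the
-- coefficients 1 and n + 1.
module Submission where

open import Algebra.Bundles.Raw using (RawRing)
import Algebra.Definitions.RawSemiring as RawSemiringDefinitions
open import Data.Bool.Base using (if_then_else_)
open import Data.Fin.Base using (Fin; zero; suc; toℕ)
open import Data.Integer.Base as ℤ using (ℤ; +_; 0ℤ; 1ℤ; -1ℤ)
import Data.Integer.Properties as ℤ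
open import Data.Integer.Tactic.RingSolver using (solve-∀)
open import Data.List.Base
  using (List; []; _∷_; [_]; _++_; _∷ʳ_; map; foldr; filter; concatMap; upTo; iterate; length)
open import Data.List.Properties
  using (map-++; concatMap-++; filter-++; filter-none; filter-accept; filter-reject
        ; ++-identityʳ; upTo-∷ʳ; length-++; length-map)
open import Data.List.Relation.Unary.All as All using (All; []; _∷_)
import Data.List.Relation.Unary.All.Properties as All
open import Data.Nat.Base as ℕ using (ℕ; zero; suc; _∸_; _<_; _≥_; s≤s⁻¹)
import Data.Nat.Properties as ℕ
open import Data.Nat.Properties using (_<?_; _≥?_)
open import Data.Product.Base using (_×_; _,_)
open import Data.Vec.Base using (lookup)
open import Function.Base using (_∘_)
open import Level as Level using (Level; 0ℓ; _⊔_)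
open import Relation.Binary.Core using (Rel)
open import Relation.Binary.Definitions using (Decidable)
open import Relation.Binary.PropositionalEquality
  using (_≡_; refl; cong; cong₂; sym; trans; module ≡-Reasoning)
open import Relation.Nullary.Decidable using (yes; no; dec-false)
open import Relation.Nullary.Negation using (¬_; contradiction)
open import Defs

-- The avoiding words

-- The recursion splits on the second letter, 0 or 1. It follows the order of `catalanWords`, so
-- that filtering yields this very list and no permutation is involved.
avoiders : ℕ → List (List ℕ)
avoiders zero          = [ [] ]
avoiders (suc zero)    = [ [ 0 ] ]
avoiders (suc (suc n)) = map (0 ∷_) (avoiders (suc n)) ∷ʳ iterate suc 0 (2 ℕ.+ n)

length-avoiders : ∀ n → length (avoiders (suc n)) ≡ suc n
length-avoiders zero    = refl
length-avoiders (suc n) = begin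
  length (map (0 ∷_) ws ∷ʳ iterate suc 0 (2 ℕ.+ n)) ≡⟨ length-++ (map (0 ∷_) ws) ⟩
  length (map (0 ∷_) ws) ℕ.+ 1                       ≡⟨ ℕ.+-comm _ 1 ⟩
  suc (length (map (0 ∷_) ws))                       ≡⟨ cong suc (length-map (0 ∷_) ws) ⟩
  suc (length ws)                                    ≡⟨ cong suc (length-avoiders n) ⟩
  suc (suc n)                                        ∎
  where
  open ≡-Reasoning
  ws = avoiders (suc n)

des-iterate-suc : ∀ a n → des (iterate suc a n) ≡ 0
des-iterate-suc a zero          = refl
des-iterate-suc a (suc zero)    = refl
des-iterate-suc a (suc (suc n)) =
  trans (cong (λ d → (if d then 1 else 0) ℕ.+ des (iterate suc (suc a) (suc n)))
              (dec-false (a ℕ.>? suc a) (ℕ.<⇒≯ (ℕ.n<1+n a))))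
        (des-iterate-suc (suc a) (suc n))

des-0∷ : ∀ w → des (0 ∷ w) ≡ des w
des-0∷ []      = refl
des-0∷ (_ ∷ _) = refl

des-avoiders : ∀ n → All (λ w → des w ≡ 0) (avoiders n)
des-avoiders zero          = refl ∷ []
des-avoiders (suc zero)    = refl ∷ []
des-avoiders (suc (suc n)) =
  All.∷ʳ⁺ (All.map⁺ (All.map (λ {w} → trans (des-0∷ w)) (des-avoiders (suc n))))
          (des-iterate-suc 0 (2 ℕ.+ n))

-- Filtering the Catalan words

module _ {X Y : Rel ℕ 0ℓ} (X? : Decidable X) (Y? : Decidable Y) where

  -- Prepending a letter keeps every occurrence, by `there`. The hypothesis is the converse, so `w`
  -- and `a ∷ w` are kept or discarded together.
  filter-avoids-map-∷ : ∀ {a ws} → All (λ w → Contains X Y (a ∷ w) → Contains X Y w) ws →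
                        filter (avoids? X? Y?) (map (a ∷_) ws) ≡
                        map (a ∷_) (filter (avoids? X? Y?) ws)
  filter-avoids-map-∷ [] = refl
  filter-avoids-map-∷ {a} {w ∷ ws} (tail ∷ tails) with contains? X? Y? w
  ... | no w∌  = trans (filter-accept (avoids? X? Y?) (w∌ ∘ tail))
                       (cong ((a ∷ w) ∷_) (filter-avoids-map-∷ tails))
  ... | yes w∋ = trans (filter-reject (avoids? X? Y?) (contradiction (there w∋)))
                       (filter-avoids-map-∷ tails)

-- What `_<_` and `_≢_` have in common: every rise satisfies `X`, and two equal adjacent letters
-- cannot begin an occurrence.
module _ {X : Rel ℕ 0ℓ} (X? : Decidable X)
         (<⇒X : ∀ {a b} → a < b → X a b) (X-irrefl : ∀ {a} → ¬ X a a) where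

  private
    avoiding : List (List ℕ) → List (List ℕ)
    avoiding = filter (avoids? X? _≥?_)

    prepend : ℕ → List ℕ → List (List ℕ)
    prepend n = concatMap (λ b → map (b ∷_) (continuations b n))

  -- After `a` and `suc a`, the Catalan condition allows third letters up to `2 + a`. Every smaller
  -- one completes an occurrence at the front; `2 + a` is again a rise, so the induction continues
  -- from `suc a`.
  avoiding-after-rise : ∀ a n →
    avoiding (map (a ∷_) (map (suc a ∷_) (continuations (suc a) n))) ≡ [ iterate suc a (2 ℕ.+ n) ]
  avoiding-after-rise a zero = filter-accept (avoids? X? _≥?_) {xs = []} λ { (there (there ())) }
  avoiding-after-rise a (suc n) = begin
    avoiding (pre (prepend n (upTo (3 ℕ.+ a))))
      ≡⟨ cong (avoiding ∘ pre ∘ prepend n) (upTo-∷ʳ (2 ℕ.+ a)) ⟨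
    avoiding (pre (prepend n (low ∷ʳ (2 ℕ.+ a))))
      ≡⟨ cong (avoiding ∘ pre) (concatMap-++ block low [ 2 ℕ.+ a ]) ⟩
    avoiding (pre (prepend n low ++ (rises ++ [])))
      ≡⟨ cong (λ ws → avoiding (pre (prepend n low ++ ws))) (++-identityʳ rises) ⟩
    avoiding (pre (prepend n low ++ rises))
      ≡⟨ cong avoiding (trans (cong (map (a ∷_)) (map-++ (suc a ∷_) (prepend n low) rises))
                              (map-++ (a ∷_) (map (suc a ∷_) (prepend n low)) _)) ⟩
    avoiding (pre (prepend n low) ++ pre rises)
      ≡⟨ filter-++ (avoids? X? _≥?_) (pre (prepend n low)) (pre rises) ⟩
    avoiding (pre (prepend n low)) ++ avoiding (pre rises)
      ≡⟨ cong (_++ avoiding (pre rises)) (filter-none (avoids? X? _≥?_) none) ⟩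
    avoiding (pre rises)
      -- The letter `a` can be stripped: an occurrence starting at it would need `suc a ≥ 2 + a`.
      ≡⟨ filter-avoids-map-∷ X? _≥?_ {ws = map (suc a ∷_) rises}
           (All.map⁺ (All.map⁺ (All.universal later (continuations (2 ℕ.+ a) n)))) ⟩
    map (a ∷_) (avoiding (map (suc a ∷_) rises))
      ≡⟨ cong (map (a ∷_)) (avoiding-after-rise (suc a) n) ⟩
    [ iterate suc a (3 ℕ.+ n) ] ∎
    where
    open ≡-Reasoning
    pre : List (List ℕ) → List (List ℕ)
    pre = map (a ∷_) ∘ map (suc a ∷_)
    low = upTo (2 ℕ.+ a)
    rises = map ((2 ℕ.+ a) ∷_) (continuations (2 ℕ.+ a) n)

    block : ℕ → List (List ℕ)
    block b = map (b ∷_) (continuations b n)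

    none : All (λ w → ¬ Avoids X _≥_ w) (pre (prepend n low))
    none = All.map⁺ (All.map⁺ (All.concat⁺ (All.map⁺ {f = block} (All.map
      (λ {b} b<2+a → All.map⁺ (All.universal
        (λ _ aw∌ → aw∌ (here (<⇒X (ℕ.n<1+n a)) (s≤s⁻¹ b<2+a))) (continuations b n)))
      (All.all-upTo (2 ℕ.+ a))))))

    later : ∀ w → Contains X _≥_ (a ∷ suc a ∷ 2 ℕ.+ a ∷ w) → Contains X _≥_ (suc a ∷ 2 ℕ.+ a ∷ w)
    later w (here _ 1+a≥2+a) = contradiction 1+a≥2+a (ℕ.<⇒≱ (ℕ.n<1+n (suc a)))
    later w (there found)    = found

  avoiding-catalanWords : ∀ n → avoiding (catalanWords n) ≡ avoiders n
  avoiding-catalanWords zero          = filter-accept (avoids? X? _≥?_) {xs = []} λ ()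
  avoiding-catalanWords (suc zero)    = filter-accept (avoids? X? _≥?_) {xs = []} λ { (there ()) }
  avoiding-catalanWords (suc (suc n)) = begin
    -- By computation, the continuations of 0 that begin with 0 form `catalanWords (suc n)`, and
    -- those that begin with 1 form `ones`.
    avoiding (map (0 ∷_) (catalanWords (suc n) ++ (ones ++ [])))
      ≡⟨ cong (λ ws → avoiding (map (0 ∷_) (catalanWords (suc n) ++ ws))) (++-identityʳ ones) ⟩
    avoiding (map (0 ∷_) (catalanWords (suc n) ++ ones))
      ≡⟨ cong avoiding (map-++ (0 ∷_) (catalanWords (suc n)) ones) ⟩
    avoiding (map (0 ∷_) (catalanWords (suc n)) ++ map (0 ∷_) ones)
      ≡⟨ filter-++ (avoids? X? _≥?_) (map (0 ∷_) (catalanWords (suc n))) (map (0 ∷_) ones) ⟩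
    avoiding (map (0 ∷_) (catalanWords (suc n))) ++ avoiding (map (0 ∷_) ones)
      ≡⟨ cong₂ _++_ (filter-avoids-map-∷ X? _≥?_ {ws = catalanWords (suc n)}
                      (All.map⁺ (All.universal later (continuations 0 n))))
                    (avoiding-after-rise 0 n) ⟩
    map (0 ∷_) (avoiding (catalanWords (suc n))) ∷ʳ iterate suc 0 (2 ℕ.+ n)
      ≡⟨ cong (λ ws → map (0 ∷_) ws ∷ʳ iterate suc 0 (2 ℕ.+ n)) (avoiding-catalanWords (suc n)) ⟩
    avoiders (2 ℕ.+ n) ∎
    where
    open ≡-Reasoning
    ones = map (1 ∷_) (continuations 1 n)

    later : ∀ w → Contains X _≥_ (0 ∷ 0 ∷ w) → Contains X _≥_ (0 ∷ w)
    later _ (here X00 _)  = contradiction X00 X-irrefl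
    later _ (there found) = found

-- Relations between rings, lifted to power series

-- A relation rather than a homomorphism, since a constant polynomial has many coefficient lists.
-- Transport along it uses neither ring laws nor congruence of the operations.
record RawRingRelation {c ℓ c′ ℓ′ : Level} (R : RawRing c ℓ) (S : RawRing c′ ℓ′) (r : Level) :
                       Set (c ⊔ c′ ⊔ Level.suc r) where
  private
    module R = RawRing R
    module S = RawRing S
  infix 4 _~_
  field
    _~_ : R.Carrier → S.Carrier → Set r
    0~  : R.0# ~ S.0#
    1~  : R.1# ~ S.1#
    +~  : ∀ {a a′ b b′} → a ~ a′ → b ~ b′ → a R.+ b ~ a′ S.+ b′
    *~  : ∀ {a a′ b b′} → a ~ a′ → b ~ b′ → a R.* b ~ a′ S.* b′
    -~  : ∀ {a a′} → a ~ a′ → R.- a ~ S.- a′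

module SeriesRelation {c ℓ c′ ℓ′ r : Level} {R : RawRing c ℓ} {S : RawRing c′ ℓ′}
                      (relation : RawRingRelation R S r) where

  open RawRingRelation relation
  private
    module R = RawRing R
    module S = RawRing S
    module R⟦x⟧ = PowerSeries R
    module S⟦x⟧ = PowerSeries S
    module RD = RawSemiringDefinitions R.rawSemiring
    module SD = RawSemiringDefinitions S.rawSemiring

  -- A record rather than a function type, so that f and g can be inferred.
  infix 4 _≋_
  record _≋_ (f : R⟦x⟧.Series) (g : S⟦x⟧.Series) : Set r where
    constructor coefficientwise
    field at : ∀ n → f n ~ g n
  open _≋_ public

  sum~ : ∀ {n} {s : Fin n → R.Carrier} {t : Fin n → S.Carrier} →
         (∀ i → s i ~ t i) → RD.sum s ~ SD.sum t
  sum~ {zero}  s~t = 0~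
  sum~ {suc n} s~t = +~ (s~t zero) (sum~ (s~t ∘ suc))

  1≋ : R⟦x⟧.1# ≋ S⟦x⟧.1#
  1≋ = coefficientwise λ { zero → 1~ ; (suc _) → 0~ }

  x≋ : R⟦x⟧.x ≋ S⟦x⟧.x
  x≋ = coefficientwise λ { zero → 0~ ; (suc zero) → 1~ ; (suc (suc _)) → 0~ }

  +≋ : ∀ {f f′ g g′} → f ≋ f′ → g ≋ g′ → f R⟦x⟧.+ g ≋ f′ S⟦x⟧.+ g′
  +≋ f≋ g≋ = coefficientwise λ n → +~ (at f≋ n) (at g≋ n)

  -≋ : ∀ {f f′ g g′} → f ≋ f′ → g ≋ g′ → f R⟦x⟧.- g ≋ f′ S⟦x⟧.- g′
  -≋ f≋ g≋ = coefficientwise λ n → +~ (at f≋ n) (-~ (at g≋ n))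

  *≋ : ∀ {f f′ g g′} → f ≋ f′ → g ≋ g′ → f R⟦x⟧.* g ≋ f′ S⟦x⟧.* g′
  *≋ f≋ g≋ = coefficientwise λ n → sum~ {suc n} λ i → *~ (at f≋ (toℕ i)) (at g≋ (n ∸ toℕ i))

  ^≋ : ∀ {f f′} k → f ≋ f′ → f R⟦x⟧.^ k ≋ f′ S⟦x⟧.^ k
  ^≋ zero    f≋ = 1≋
  ^≋ (suc k) f≋ = *≋ f≋ (^≋ k f≋)

  private
    -- Stated for every entry and not only for the head, because each new coefficient is computed
    -- from all earlier ones.
    reciprocalCoeffs~ : ∀ {f f′} → f ≋ f′ → ∀ n i →
      lookup (R⟦x⟧.reciprocalCoeffs f n) i ~ lookup (S⟦x⟧.reciprocalCoeffs f′ n) i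
    reciprocalCoeffs~ f≋ zero    zero    = 1~
    reciprocalCoeffs~ f≋ (suc n) zero    =
      -~ (sum~ λ i → *~ (at f≋ (suc (toℕ i))) (reciprocalCoeffs~ f≋ n i))
    reciprocalCoeffs~ f≋ (suc n) (suc i) = reciprocalCoeffs~ f≋ n i

  ⁻¹≋ : ∀ {f f′} → f ≋ f′ → f R⟦x⟧.⁻¹ ≋ f′ S⟦x⟧.⁻¹
  -- The case split lets `reciprocalCoeffs` reduce, so that its head becomes its entry at `zero`.
  ⁻¹≋ f≋ = coefficientwise λ
    { zero    → reciprocalCoeffs~ f≋ zero zero
    ; (suc n) → reciprocalCoeffs~ f≋ (suc n) zero
    }

  /≋ : ∀ {f f′ g g′} → f ≋ f′ → g ≋ g′ → f R⟦x⟧./ g ≋ f′ S⟦x⟧./ g′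
  /≋ f≋ g≋ = *≋ f≋ (⁻¹≋ g≋)

-- Constant polynomials

open ℤ[y] using (Poly; coeff; _≈ₚ_; _+ₚ_; _*ₚ_)

coeff-+ₚ : ∀ p q k → coeff (p +ₚ q) k ≡ coeff p k ℤ.+ coeff q k
coeff-+ₚ []      q       k       = sym (ℤ.+-identityˡ _)
coeff-+ₚ (a ∷ p) []      k       = sym (ℤ.+-identityʳ _)
coeff-+ₚ (a ∷ p) (b ∷ q) zero    = refl
coeff-+ₚ (a ∷ p) (b ∷ q) (suc k) = coeff-+ₚ p q k

coeff-map : ∀ {f : ℤ → ℤ} → f 0ℤ ≡ 0ℤ → ∀ p k → coeff (map f p) k ≡ f (coeff p k)
coeff-map f0≡0 []      k       = sym f0≡0
coeff-map f0≡0 (a ∷ p) zero    = refl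
coeff-map f0≡0 (a ∷ p) (suc k) = coeff-map f0≡0 p k

-- A zero polynomial may be a nonempty list of zeros, whose product with `q` need not be the list
-- `[]`.
*ₚ-zeroˡ : ∀ p q → p ≈ₚ [] → p *ₚ q ≈ₚ []
*ₚ-zeroˡ []      q p≈0 k = refl
*ₚ-zeroˡ (a ∷ p) q p≈0 k = begin
  coeff (map (a ℤ.*_) q +ₚ (0ℤ ∷ p *ₚ q)) k             ≡⟨ coeff-+ₚ (map (a ℤ.*_) q) _ k ⟩
  coeff (map (a ℤ.*_) q) k ℤ.+ coeff (0ℤ ∷ p *ₚ q) k    ≡⟨ cong₂ ℤ._+_ scaled (shifted k) ⟩
  0ℤ                                                    ∎
  where
  open ≡-Reasoning
  scaled : coeff (map (a ℤ.*_) q) k ≡ 0ℤ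
  scaled = trans (coeff-map {a ℤ.*_} (ℤ.*-zeroʳ a) q k) (cong (ℤ._* coeff q k) (p≈0 0))
  shifted : 0ℤ ∷ p *ₚ q ≈ₚ []
  shifted zero    = refl
  shifted (suc k) = *ₚ-zeroˡ p q (p≈0 ∘ suc) k

infix 4 _≐_
_≐_ : Poly → ℤ → Set
p ≐ a = p ≈ₚ [ a ]

0≐ : [] ≐ 0ℤ
0≐ zero    = refl
0≐ (suc k) = refl

+-≐ : ∀ {p q a b} → p ≐ a → q ≐ b → p +ₚ q ≐ a ℤ.+ b
+-≐ {p} {q} p≐a q≐b k =
  trans (coeff-+ₚ p q k) (trans (cong₂ ℤ._+_ (p≐a k) (q≐b k)) (sym (coeff-+ₚ [ _ ] [ _ ] k)))

neg-≐ : ∀ {p a} → p ≐ a → map (ℤ.-_) p ≐ ℤ.- a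
neg-≐ {p} {a} p≐a k =
  trans (coeff-map {ℤ.-_} refl p k)
        (trans (cong (ℤ.-_) (p≐a k)) (sym (coeff-map {ℤ.-_} refl [ a ] k)))

-- The tail of `p` vanishes, so by `*ₚ-zeroˡ` the shifted summand drops out and `q` scaled by `a`
-- remains.
*-≐ : ∀ {p q a b} → p ≐ a → q ≐ b → p *ₚ q ≐ a ℤ.* b
-- The empty list forces `a` to be 0.
*-≐ {[]} {b = b} p≐a q≐b k rewrite sym (p≐a 0) = 0≐ k
*-≐ {a′ ∷ p} {q} {a} {b} p≐a q≐b k rewrite p≐a 0 = begin
  coeff (map (a ℤ.*_) q +ₚ (0ℤ ∷ p *ₚ q)) k          ≡⟨ coeff-+ₚ (map (a ℤ.*_) q) _ k ⟩
  coeff (map (a ℤ.*_) q) k ℤ.+ coeff (0ℤ ∷ p *ₚ q) k ≡⟨ cong₂ ℤ._+_ (coeff-map {a ℤ.*_} (ℤ.*-zeroʳ a) q k) (shifted k) ⟩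
  a ℤ.* coeff q k ℤ.+ 0ℤ                             ≡⟨ ℤ.+-identityʳ _ ⟩
  a ℤ.* coeff q k                                    ≡⟨ cong (a ℤ.*_) (q≐b k) ⟩
  a ℤ.* coeff [ b ] k                                ≡⟨ coeff-map {a ℤ.*_} (ℤ.*-zeroʳ a) [ b ] k ⟨
  coeff [ a ℤ.* b ] k                                ∎
  where
  open ≡-Reasoning
  shifted : 0ℤ ∷ p *ₚ q ≈ₚ []
  shifted zero    = refl
  shifted (suc k) = *ₚ-zeroˡ p q (p≐a ∘ suc) k

-- Comparison of power series over ℤ[y] and over ℤ

module ℤ⟦x⟧ = PowerSeries ℤ.+-*-rawRing

≐-relation : RawRingRelation ℤ[y].rawRing ℤ.+-*-rawRing 0ℓ
≐-relation = record
  { _~_ = _≐_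
  ; 0~  = 0≐
  ; 1~  = λ _ → refl
  ; +~  = λ {p} {_} {q} → +-≐ {p} {q}
  ; *~  = λ {p} {_} {q} → *-≐ {p} {q}
  ; -~  = λ {p} → neg-≐ {p}
  }

open SeriesRelation ≐-relation

-- Reduces an identity in ℤ[y]⟦x⟧ whose sides are free of `y` to an identity of integer
-- coefficients.
≋⇒≈ : ∀ {f g a b} → f ≋ a → g ≋ b → (∀ n → a n ≡ b n) → f ℤ[y]⟦x⟧.≈ g
≋⇒≈ f≋a g≋b a≡b n k rewrite at f≋a n k | at g≋b n k | a≡b n = refl

module _ where
  open RawRing ℤ[y].rawRing using (rawSemiring; _+_; 0#)
  open RawSemiringDefinitions rawSemiring using (_^_)

  -- Every summand is `y ^ 0`, that is 1, so the sum counts the words.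
  sum-y^des : ∀ {ws} → All (λ w → des w ≡ 0) ws →
              foldr _+_ 0# (map (λ w → y ^ des w) ws) ≐ + length ws
  sum-y^des []                     = 0≐
  sum-y^des {w ∷ ws} (des≡0 ∷ all) rewrite des≡0 =
    +-≐ {[ 1ℤ ]} {foldr _+_ 0# (map (λ v → y ^ des v) ws)} (λ _ → refl) (sum-y^des all)

-- Evaluation in ℤ⟦x⟧

module Evaluation where
  open ℤ⟦x⟧
  open PowerSeriesProperties ℤ.+-*-ring using (*-inverseʳ)
  open RawSemiringDefinitions (RawRing.rawSemiring ℤ.+-*-rawRing) using (sum)
  open import Algebra.Properties.Monoid.Sum ℤ.+-0-monoid using (sum-cong-≗; sum-replicate-zero)

  -- For `f` of degree at most 2, only three terms of the Cauchy product survive. From degree 2 on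
  -- all three indices exist; degrees 0 and 1 are treated separately wherever this is applied to a
  -- series of unknown degree.
  quadratic-* : ∀ f g → (∀ n → f (3 ℕ.+ n) ≡ 0ℤ) → ∀ n →
    (f * g) (2 ℕ.+ n) ≡ f 0 ℤ.* g (2 ℕ.+ n) ℤ.+ f 1 ℤ.* g (1 ℕ.+ n) ℤ.+ f 2 ℤ.* g n
  quadratic-* f g f≡0 n = begin
    a ℤ.+ (b ℤ.+ (c ℤ.+ sum {n} λ i → f (3 ℕ.+ toℕ i) ℤ.* g (n ∸ suc (toℕ i))))
      ≡⟨ cong (λ s → a ℤ.+ (b ℤ.+ (c ℤ.+ s))) vanish ⟩
    a ℤ.+ (b ℤ.+ (c ℤ.+ 0ℤ))
      ≡⟨ cong (λ s → a ℤ.+ (b ℤ.+ s)) (ℤ.+-identityʳ c) ⟩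
    a ℤ.+ (b ℤ.+ c)
      ≡⟨ ℤ.+-assoc a b c ⟨
    a ℤ.+ b ℤ.+ c ∎
    where
    open ≡-Reasoning
    a = f 0 ℤ.* g (2 ℕ.+ n)
    b = f 1 ℤ.* g (1 ℕ.+ n)
    c = f 2 ℤ.* g n
    vanish : sum {n} (λ i → f (3 ℕ.+ toℕ i) ℤ.* g (n ∸ suc (toℕ i))) ≡ 0ℤ
    vanish = trans (sum-cong-≗ {n} λ i → cong (ℤ._* g (n ∸ suc (toℕ i))) (f≡0 (toℕ i)))
                   (sum-replicate-zero n)

  1-x : Series
  1-x = 1# - x

  1*-≡ : ∀ g n → (1# * g) n ≡ g n
  1*-≡ g zero          = trans (ℤ.+-identityʳ _) (ℤ.*-identityˡ _)
  1*-≡ g (suc zero)    = one (g 1) (g 0)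
    where one : ∀ a b → 1ℤ ℤ.* a ℤ.+ (0ℤ ℤ.* b ℤ.+ 0ℤ) ≡ a
          one = solve-∀
  1*-≡ g (suc (suc n)) = trans (quadratic-* 1# g (λ _ → refl) n) (two (g (2 ℕ.+ n)) (g (1 ℕ.+ n)) (g n))
    where two : ∀ a b c → 1ℤ ℤ.* a ℤ.+ 0ℤ ℤ.* b ℤ.+ 0ℤ ℤ.* c ≡ a
          two = solve-∀

  -- In degree `2 + n`, the equation `1-x * g ≈ 1#` says that two consecutive coefficients of `g`
  -- agree.
  [1-x]⁻¹ : ∀ n → (1-x ⁻¹) n ≡ 1ℤ
  [1-x]⁻¹ zero          = refl
  [1-x]⁻¹ (suc zero)    = refl
  [1-x]⁻¹ (suc (suc n)) = trans (ℤ.i-j≡0⇒i≡j (g (2 ℕ.+ n)) (g (1 ℕ.+ n)) recurrence) ([1-x]⁻¹ (suc n))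
    where
    open ≡-Reasoning
    g = 1-x ⁻¹
    shape : ∀ a b c → a ℤ.- b ≡ 1ℤ ℤ.* a ℤ.+ -1ℤ ℤ.* b ℤ.+ 0ℤ ℤ.* c
    shape = solve-∀
    recurrence : g (2 ℕ.+ n) ℤ.- g (1 ℕ.+ n) ≡ 0ℤ
    recurrence = begin
      g (2 ℕ.+ n) ℤ.- g (1 ℕ.+ n) ≡⟨ shape (g (2 ℕ.+ n)) (g (1 ℕ.+ n)) (g n) ⟩
      _                           ≡⟨ quadratic-* 1-x g (λ _ → refl) n ⟨
      (1-x * g) (2 ℕ.+ n)         ≡⟨ *-inverseʳ 1-x refl (2 ℕ.+ n) ⟩
      0ℤ                          ∎

  1/[1-x] : ∀ n → (1# / 1-x) n ≡ 1ℤ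
  1/[1-x] n = trans (1*-≡ (1-x ⁻¹) n) ([1-x]⁻¹ n)

  x/[1-x] : ∀ n → (x / 1-x) (suc n) ≡ 1ℤ
  x/[1-x] zero    = refl
  x/[1-x] (suc n) = begin
    (x * g) (2 ℕ.+ n)                                          ≡⟨ quadratic-* x g (λ _ → refl) n ⟩
    0ℤ ℤ.* g (2 ℕ.+ n) ℤ.+ 1ℤ ℤ.* g (1 ℕ.+ n) ℤ.+ 0ℤ ℤ.* g n ≡⟨ shape (g (2 ℕ.+ n)) (g (1 ℕ.+ n)) (g n) ⟩
    g (1 ℕ.+ n)                                                ≡⟨ [1-x]⁻¹ (suc n) ⟩
    1ℤ                                                         ∎
    where
    open ≡-Reasoning
    g = 1-x ⁻¹
    shape : ∀ a b c → 0ℤ ℤ.* a ℤ.+ 1ℤ ℤ.* b ℤ.+ 0ℤ ℤ.* c ≡ b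
    shape = solve-∀

  1/[1-x]*x/[1-x] : ∀ n → ((1# / 1-x) * (x / 1-x)) n ≡ + n
  1/[1-x]*x/[1-x] n = trans
    (sum-cong-≗ {suc n} λ i → trans (cong (ℤ._* (x / 1-x) (n ∸ toℕ i)) (1/[1-x] (toℕ i))) (ℤ.*-identityˡ _))
    (partialSums n)
    where
    -- The sum ends at the constant term of `x / 1-x`, which is 0; hence `n + 1` summands add up to
    -- `n`.
    partialSums : ∀ n → sum {suc n} (λ i → (x / 1-x) (n ∸ toℕ i)) ≡ + n
    partialSums zero    = refl
    partialSums (suc n) = cong₂ ℤ._+_ (x/[1-x] n) (partialSums n)

  -- The degree bound that `quadratic-*` requires of the denominator: each of the two factors `1-x`
  -- raises the degree by one.
  [1-x]²-quadratic : ∀ n → (1-x ^ 2) (3 ℕ.+ n) ≡ 0ℤ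
  [1-x]²-quadratic n
    rewrite quadratic-* 1-x (1-x ^ 1) (λ _ → refl) (suc n)
          | quadratic-* 1-x 1# (λ _ → refl) n = refl

  -- Multiplying by the denominator gives `g (2 + n) - 2 g (1 + n) + g n = 0`, so the coefficients
  -- continue the arithmetic progression begun by 1 and 2.
  [1-x]⁻² : ∀ n → ((1-x ^ 2) ⁻¹) n ≡ + suc n
  [1-x]⁻² zero          = refl
  [1-x]⁻² (suc zero)    = refl
  [1-x]⁻² (suc (suc n)) = ℤ.i-j≡0⇒i≡j (g (2 ℕ.+ n)) (+ (3 ℕ.+ n)) (begin
    g (2 ℕ.+ n) ℤ.- + (3 ℕ.+ n)
      ≡⟨ shape (g (2 ℕ.+ n)) (+ n) ⟩
    1ℤ ℤ.* g (2 ℕ.+ n) ℤ.+ (ℤ.- + 2) ℤ.* (+ 2 ℤ.+ + n) ℤ.+ 1ℤ ℤ.* (1ℤ ℤ.+ + n)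
      ≡⟨ cong₂ (λ a b → 1ℤ ℤ.* g (2 ℕ.+ n) ℤ.+ (ℤ.- + 2) ℤ.* a ℤ.+ 1ℤ ℤ.* b) ([1-x]⁻² (suc n)) ([1-x]⁻² n) ⟨
    1ℤ ℤ.* g (2 ℕ.+ n) ℤ.+ (ℤ.- + 2) ℤ.* g (1 ℕ.+ n) ℤ.+ 1ℤ ℤ.* g n
      ≡⟨ quadratic-* (1-x ^ 2) g [1-x]²-quadratic n ⟨
    ((1-x ^ 2) * g) (2 ℕ.+ n)
      ≡⟨ *-inverseʳ (1-x ^ 2) refl (2 ℕ.+ n) ⟩
    0ℤ ∎)
    where
    open ≡-Reasoning
    g = (1-x ^ 2) ⁻¹
    shape : ∀ a m → a ℤ.- (+ 3 ℤ.+ m) ≡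
                    1ℤ ℤ.* a ℤ.+ (ℤ.- + 2) ℤ.* (+ 2 ℤ.+ m) ℤ.+ 1ℤ ℤ.* (1ℤ ℤ.+ m)
    shape = solve-∀

  numerator-quadratic : ∀ n → (1-x + x ^ 2) (3 ℕ.+ n) ≡ 0ℤ
  numerator-quadratic n
    rewrite quadratic-* x (x ^ 1) (λ _ → refl) (suc n)
          | quadratic-* x 1# (λ _ → refl) n = refl

  -- The integer series to which every side of the theorem is compared. It is `n` for positive `n`
  -- but 1 at 0, from the empty word; in `sum-form` the summand `1#` accounts for that word.
  value : ℕ → ℤ
  value n = + length (avoiders n)

  sum-form : ∀ n → (1# + (1# / 1-x) * (x / 1-x)) n ≡ value n
  sum-form zero    = refl
  sum-form (suc n) =
    trans (ℤ.+-identityˡ _) (trans (1/[1-x]*x/[1-x] (suc n)) (cong +_ (sym (length-avoiders n))))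

  -- The numerator has coefficients 1, -1, 1, and from degree 2 on the claim amounts to
  -- `(n + 3) - (n + 2) + (n + 1) = n + 2`.
  fraction-form : ∀ n → ((1-x + x ^ 2) / (1-x ^ 2)) n ≡ value n
  fraction-form zero          = refl
  fraction-form (suc zero)    = refl
  fraction-form (suc (suc n)) = begin
    ((1-x + x ^ 2) * g) (2 ℕ.+ n)
      ≡⟨ quadratic-* (1-x + x ^ 2) g numerator-quadratic n ⟩
    1ℤ ℤ.* g (2 ℕ.+ n) ℤ.+ -1ℤ ℤ.* g (1 ℕ.+ n) ℤ.+ 1ℤ ℤ.* g n
      ≡⟨ cong₂ ℤ._+_ (cong₂ (λ a b → 1ℤ ℤ.* a ℤ.+ -1ℤ ℤ.* b) ([1-x]⁻² (2 ℕ.+ n)) ([1-x]⁻² (1 ℕ.+ n)))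
                     (cong (1ℤ ℤ.*_) ([1-x]⁻² n)) ⟩
    1ℤ ℤ.* (+ 3 ℤ.+ + n) ℤ.+ -1ℤ ℤ.* (+ 2 ℤ.+ + n) ℤ.+ 1ℤ ℤ.* (1ℤ ℤ.+ + n)
      ≡⟨ shape (+ n) ⟩
    + (2 ℕ.+ n)
      ≡⟨ cong +_ (length-avoiders (suc n)) ⟨
    value (2 ℕ.+ n) ∎
    where
    open ≡-Reasoning
    g = (1-x ^ 2) ⁻¹
    shape : ∀ m → 1ℤ ℤ.* (+ 3 ℤ.+ m) ℤ.+ -1ℤ ℤ.* (+ 2 ℤ.+ m) ℤ.+ 1ℤ ℤ.* (1ℤ ℤ.+ m) ≡ + 2 ℤ.+ m
    shape = solve-∀

-- The generating functions and their closed forms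

C≋value : ∀ {X : Rel ℕ 0ℓ} (X? : Decidable X) →
          (∀ {a b} → a < b → X a b) → (∀ {a} → ¬ X a a) → C X? _≥?_ ≋ Evaluation.value
C≋value X? <⇒X X-irrefl = coefficientwise λ n k →
  trans (cong (λ ws → coeff (foldr _+ₚ_ [] (map (λ w → y ^ des w) ws)) k)
              (avoiding-catalanWords X? <⇒X X-irrefl n))
        (sum-y^des (des-avoiders n) k)
  where open RawSemiringDefinitions (RawRing.rawSemiring ℤ[y].rawRing) using (_^_)

open Evaluation using (value; sum-form; fraction-form)
open ℤ[y]⟦x⟧

theorem3p35 : (C _<?_ _≥?_ ≈ C _≢?_ _≥?_)
    × (C _≢?_ _≥?_ ≈ 1# + (1# / (1# - x)) * (x / (1# - x)))
    × (1# + (1# / (1# - x)) * (x / (1# - x)) ≈ ((1# - x) + x ^ 2) / ((1# - x) ^ 2))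
theorem3p35 =
    ≋⇒≈ C<≋ C≢≋ (λ _ → refl)
  , ≋⇒≈ C≢≋ sum≋ (sym ∘ sum-form)
  , ≋⇒≈ sum≋ fraction≋ (λ n → trans (sum-form n) (sym (fraction-form n)))
  where
  C<≋ : C _<?_ _≥?_ ≋ value
  C<≋ = C≋value _<?_ (λ a<b → a<b) (ℕ.<-irrefl refl)

  C≢≋ : C _≢?_ _≥?_ ≋ value
  C≢≋ = C≋value _≢?_ ℕ.<⇒≢ (λ a≢a → a≢a refl)

  1-x≋ : 1# - x ≋ Evaluation.1-x
  1-x≋ = -≋ 1≋ x≋

  -- The underscore is solved by the same expression read in ℤ⟦x⟧, as the lifted operations build
  -- both sides in parallel.
  sum≋ : 1# + (1# / (1# - x)) * (x / (1# - x)) ≋ _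
  sum≋ = +≋ 1≋ (*≋ (/≋ 1≋ 1-x≋) (/≋ x≋ 1-x≋))

  fraction≋ : ((1# - x) + x ^ 2) / ((1# - x) ^ 2) ≋ _
  fraction≋ = /≋ (+≋ 1-x≋ (^≋ 2 x≋)) (^≋ 2 1-x≋)
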